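{- Let $g \ge 3$ be an integer such that $$\left\lceil \frac{3+\sqrt{8g+1}}{2} \right\rceil = \left\lfloor \frac{7+\sqrt{32g-15}}{4} \right\rfloor .$$ Then $$|V|_{\min}(g) = 2\left\lceil \frac{3+\sqrt{8g+1}}{2} \right\rceil ,$$ where $|V|_{\min}(g)$ is the smallest number of vertices of a quadrangulation on the closed orientable 2-manifold $\Sigma_g$ of genus $g$.
   Context: Graphs are finite and simple (no loops; any two vertices are joined by at most one edge). $\Sigma_g$ denotes the closed (connected) orientable 2-manifold of genus $g$. A polyhedron $G \hookrightarrow \Sigma_g$ with 1-skeleton $G$ is a cellular embedding of the connected graph $G$ in $\Sigma_g$, i.e. every component (face, region) of the complement of $G$ in $\Sigma_g$ is an open disk. It is called a quadrangulation on $\Sigma_g$ if each face is bounded by a cycle of four edges in $G$. No further condition is imposed on how distinct faces intersect. A quadrangulation on $\Sigma_g$ is minimal for $\Sigma_g$ if no quadrangulation on $\Sigma_g$ has fewer vertices, and $|V|_{\min}(g)$ denotes the number of vertices in a minimal quadrangulation on $\Sigma_g$. -}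

module Defs where

open import Data.Bool.Base using (Bool; T)
open import Data.Fin.Base using (Fin; toℕ)
open import Data.Integer.Base as ℤ using (+_)
open import Data.Nat.Base using (ℕ; _+_; _*_; _∸_; _^_; _≤_; NonZero)
open import Data.Nat.GeneralisedArithmetic using (iterate)
open import Data.Product.Base using (Σ; _×_; _,_; ∃; proj₁)
open import Function.Bundles using (Bijection)
open import Function.Definitions using (Injective; Bijective)
open import Relation.Binary.Bundles using (Setoid)
open import Relation.Binary.Construct.Closure.ReflexiveTransitive using (Star)
open import Relation.Binary.Definitions using (Irreflexive; Symmetric)
open import Relation.Binary.PropositionalEquality.Core using (_≡_)
import Relation.Binary.Construct.Closure.Equivalence as EqClosure
import Relation.Binary.PropositionalEquality.Properties as ≡

-- For a permutation f, the equivalence relation generated by x ∼ f x has the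
-- orbits of f as its classes; OrbitCount f m says that there are exactly m.

Orbits : {A : Set} → (A → A) → Setoid _ _
Orbits f = EqClosure.setoid (λ x y → y ≡ f x)

OrbitCount : {A : Set} → (A → A) → ℕ → Set
OrbitCount f m = Bijection (Orbits f) (≡.setoid (Fin m))

CyclicPermutation : {A : Set} → (A → A) → Set
CyclicPermutation f =
  Bijective _≡_ _≡_ f × (∀ x y → ∃ λ k → iterate f x k ≡ y)

-- Finite simple graphs with vertex set Fin n.

record Graph (n : ℕ) : Set where
  field
    adj : Fin n → Fin n → Bool

  Adj : Fin n → Fin n → Set
  Adj u v = T (adj u v)

  field
    loopless  : Irreflexive _≡_ Adj
    symmetric : Symmetric Adj

  Connected : Set
  Connected = ∀ u v → Star Adj u v

  Neighbour : Fin n → Set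
  Neighbour v = Σ (Fin n) (Adj v)

-- An edge with a direction of traversal.
record Dart {n : ℕ} (G : Graph n) : Set where
  constructor dart
  field
    tail head : Fin n
    adjacent  : Graph.Adj G tail head

-- Edges are the orbits of this involution.
opposite : ∀ {n} {G : Graph n} → Dart G → Dart G
opposite {G = G} (dart u v uv) = dart v u (Graph.symmetric G uv)

-- Cellular embeddings of a connected graph in closed oriented surfaces are
-- encoded by rotation systems (Heffter–Edmonds): at every vertex v the
-- neighbours are arranged cyclically, and next v w follows w around v.

record RotationSystem {n : ℕ} (G : Graph n) : Set where
  open Graph G
  field
    next   : ∀ v → Neighbour v → Neighbour v
    cyclic : ∀ v → CyclicPermutation (next v)

  -- Having traversed u → v, the boundary walk of the face on a fixed side
  -- continues from v to the neighbour following u around v.  The faces are the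
  -- orbits of this permutation of the darts (as soon as G has an edge).
  traceFace : Dart G → Dart G
  traceFace (dart u v uv) =
    let (w , vw) = next v (u , symmetric uv) in dart v w vw

  -- The boundary walk of the face through d closes up after four steps and
  -- visits four distinct vertices, i.e. it is a cycle of length four.
  BoundedBy4Cycle : Dart G → Set
  BoundedBy4Cycle d =
    iterate traceFace d 4 ≡ d ×
    Injective _≡_ _≡_ (λ (i : Fin 4) → Dart.tail (iterate traceFace d (toℕ i)))

  -- For connected G, gluing disks to all face boundary walks yields a closed
  -- connected orientable surface; its genus is determined by V − E + F = 2 − 2g.
  HasGenus : ℕ → Set
  HasGenus g = ∃ λ E → ∃ λ F →
    OrbitCount (opposite {G = G}) E × OrbitCount traceFace F ×
    (+ n ℤ.- + E ℤ.+ + F ≡ + 2 ℤ.- + (2 * g))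

record Quadrangulation (g n : ℕ) : Set where
  field
    skeleton  : Graph n
    connected : Graph.Connected skeleton
    -- Excludes the null graph, and the single vertex on the sphere, whose only
    -- face has no darts on its boundary.
    someDart  : Dart skeleton
    embedding : RotationSystem skeleton

  open RotationSystem embedding public

  field
    genus         : HasGenus g
    quadrilateral : ∀ d → BoundedBy4Cycle d

-- |V|min(g) = m.
∣V∣min[_]≡_ : ℕ → ℕ → Set
∣V∣min[ g ]≡ m = Quadrangulation g m × (∀ n → Quadrangulation g n → m ≤ n)

-- The nonnegative real number (a + √b) / c, compared with natural numbers k by
-- comparing √b with c k − a.  Since it is nonnegative, its ceiling and floor
-- can be characterised among the natural numbers.

record Surd : Set where
  constructor [_+√_]/_
  field
    a b c : ℕ
    .{{c≢0}} : NonZero c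

_≤ˢ_ : Surd → ℕ → Set
([ a +√ b ]/ c) ≤ˢ k = a ≤ c * k × b ≤ (c * k ∸ a) ^ 2

-- If c k < a then the truncated difference is 0 and the relation holds.
_ˢ≤_ : ℕ → Surd → Set
k ˢ≤ ([ a +√ b ]/ c) = (c * k ∸ a) ^ 2 ≤ b

⌈_⌉≡_ : Surd → ℕ → Set
⌈ x ⌉≡ m = x ≤ˢ m × (∀ k → x ≤ˢ k → m ≤ k)

⌊_⌋≡_ : Surd → ℕ → Set
⌊ x ⌋≡ m = m ˢ≤ x × (∀ k → k ˢ≤ x → k ≤ m)

-- Let G be a connected graph with c vertices and m edges and any rotation system.
-- Replace every vertex u by two copies (u , 0) and (u , 1), joining all copies of
-- adjacent vertices.  If u has the rotation v, w, …, give (u , 0) the rotation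
-- (v , 0), (v , 1), (w , 0), (w , 1), … and (u , 1) the inverse one.  The faces are
-- then 4-cycles, one for each of the 2 m corners of G, and as there are 4 m edges and
-- 2 c vertices the genus is m − c + 1.  Thus every g ≤ (c − 1)(c − 2) / 2, which is
-- what the ceiling guarantees, is the genus of a quadrangulation with 2 c vertices.
-- Conversely Euler's formula and E ≤ n (n − 1) / 2 force (2 n − 5)² ≥ 32 g − 7,
-- which by the floor condition excludes n < 2 c.

module Submission where

open import Defs
open import Data.Nat.Base using (ℕ; _+_; _*_; _∸_; _≤_)
open import Relation.Binary.PropositionalEquality.Core using (_≡_)
open import Data.Bool.Base using (Bool; true; false; T)
open import Data.Bool.Properties using (T-irrelevant)
open import Data.Empty using (⊥)
open import Data.Fin.Base as Fin using
  (Fin; zero; suc; toℕ; fromℕ; inject₁; combine; remQuot; punchOut)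
open import Data.Fin.Patterns using (0F; 1F; 2F; 3F)
open import Data.Fin.Properties using
  (toℕ-injective; toℕ-inject₁; toℕ-fromℕ; toℕ≤pred[n]; toℕ<n; <-cmp; *↔×; +↔⊎;
   remQuot-combine; combine-remQuot; injective⇒≤; punchOut-injective)
open import Data.Fin.Relation.Unary.Top using (view; ‵fromℕ; ‵inject₁; view-fromℕ; view-inject₁)
open import Data.Integer.Base as ℤ using (ℤ; +_)
import Data.Integer.Properties as ℤ
import Data.Integer.Tactic.RingSolver as ℤ-Solver
open import Data.Nat.Base using (zero; suc; _^_; _<_; _<ᵇ_; _⊓_; z≤n; s≤s)
open import Data.Nat.GeneralisedArithmetic using (iterate)
open import Data.Nat.Properties hiding (<-cmp)
open import Data.Nat.Tactic.RingSolver using (solve-∀)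
open import Data.Product.Base using (Σ; _×_; _,_; ∃; proj₁; proj₂)
open import Data.Product.Function.NonDependent.Propositional using (_×-↔_)
open import Data.Sum.Base using (_⊎_; inj₁; inj₂)
open import Data.Sum.Function.Propositional using (_⊎-↔_)
open import Data.Unit.Base using (tt)
open import Function.Base using (_∘_; id)
open import Function.Bundles using (Bijection; _↔_; _↣_; Inverse; Injection; mk↔ₛ′; mk↣)
open import Function.Construct.Composition using (_↔-∘_; _↣-∘_)
open import Function.Construct.Identity using (↔-id)
open import Function.Construct.Symmetry using (↔-sym)
open import Function.Properties.Inverse using (↔⇒⤖; ↔⇒↣)
open import Relation.Binary.Bundles using (Setoid)
open import Relation.Binary.Construct.Closure.ReflexiveTransitive as Star using (Star; ε; _◅_; _◅◅_)
open import Relation.Binary.Construct.Closure.Symmetric using (fwd; bwd)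
import Relation.Binary.Construct.Closure.Equivalence as EqClosure
open import Relation.Binary.Definitions using (tri<; tri≈; tri>)
open import Relation.Binary.PropositionalEquality.Core using
  (refl; sym; trans; cong; cong₂; subst; subst₂; _≢_)
open import Relation.Binary.PropositionalEquality.Properties using (module ≡-Reasoning)
open import Relation.Nullary.Negation using (contradiction)

private variable
  A B : Set
  m n : ℕ

open Inverse using (to; from; strictlyInverseˡ; strictlyInverseʳ)

-- Cyclic permutations

Reach : (A → A) → A → A → Set
Reach f = Star (λ x y → y ≡ f x)

-- Transitivity is phrased with paths, which can be concatenated, mapped and reversed;
-- `reach⇒iterate` converts them to iterates at the end.
record Cycle (A : Set) : Set where
  field
    permutation : A ↔ A
    transitive  : ∀ x y → Reach (to permutation) x y

open Cycle

reach⇒iterate : {f : A → A} → ∀ {x y} → Reach f x y → ∃ λ k → iterate f x k ≡ y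
reach⇒iterate ε          = 0 , refl
reach⇒iterate (refl ◅ r) = let (k , eq) = reach⇒iterate r in suc k , eq

cyclicPermutation : (c : Cycle A) → CyclicPermutation (to (permutation c))
cyclicPermutation c =
  Bijection.bijective (↔⇒⤖ (permutation c)) ,
  λ x y → reach⇒iterate (transitive c x y)

inverse : Cycle A → Cycle A
inverse c .permutation = ↔-sym (permutation c)
inverse c .transitive x y =
  Star.reverse (λ { refl → sym (strictlyInverseʳ (permutation c) _) }) (transitive c y x)

transport : A ↔ B → Cycle A → Cycle B
transport i c .permutation = (i ↔-∘ permutation c) ↔-∘ ↔-sym i
transport i c .transitive x y =
  subst₂ (Reach _) (strictlyInverseˡ i x) (strictlyInverseˡ i y)
    (Star.gmap (to i)
      (λ { refl → cong (to i ∘ to (permutation c)) (sym (strictlyInverseʳ i _)) })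
      (transitive c (from i x) (from i y)))

interleave : Cycle A → Cycle (A × Fin 2)
interleave {A} c = record
  { permutation = mk↔ₛ′ next prev
      (λ { (a , 0F) → cong (_, 0F) (strictlyInverseˡ (permutation c) a) ; (a , 1F) → refl })
      (λ { (a , 0F) → refl ; (a , 1F) → cong (_, 1F) (strictlyInverseʳ (permutation c) a) })
  ; transitive = λ { (a , s) (b , t) → start a s ◅◅ lift (transitive c a b) ◅◅ end b t }
  }
  where
  next prev : A × Fin 2 → A × Fin 2
  next (a , 0F) = a , 1F
  next (a , 1F) = to (permutation c) a , 0F
  prev (a , 1F) = a , 0F
  prev (a , 0F) = from (permutation c) a , 1F

  lift : ∀ {a b} → Reach (to (permutation c)) a b → Reach next (a , 1F) (b , 1F)
  lift ε          = ε
  lift (refl ◅ r) = refl ◅ refl ◅ lift r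

  start : ∀ a s → Reach next (a , s) (a , 1F)
  start a 0F = refl ◅ ε
  start a 1F = ε

  end : ∀ b t → Reach next (b , 1F) (b , t)
  end b 1F = ε
  -- `(b , 0F)` is entered only from the second copy of the predecessor of `b`, so the path first
  -- goes round the cycle to that copy.
  end b 0F =
    subst (λ b′ → Reach next (b , 1F) (b′ , 0F)) (strictlyInverseˡ (permutation c) b)
      (lift (transitive c b (from (permutation c) b)) ◅◅ refl ◅ ε)

finCycle : ∀ n → Cycle (Fin n)
finCycle zero = record { permutation = ↔-id _ ; transitive = λ () }
finCycle (suc n) = record
  { permutation = mk↔ₛ′ next prev next∘prev prev∘next
  -- The permutation counts down and jumps from 0 to the top: descend from `x` to 0, jump, then
  -- descend to `y`.
  ; transitive  = λ x y →
      descend (toℕ x) x zero (sym (+-identityʳ _)) ◅◅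
      refl ◅ descend (n ∸ toℕ y) (fromℕ n) y
        (trans (toℕ-fromℕ n) (sym (m∸n+n≡m (toℕ≤pred[n] y))))
  }
  where
  next prev : Fin (suc n) → Fin (suc n)
  next zero    = fromℕ n
  next (suc i) = inject₁ i
  prev i with view i
  ... | ‵fromℕ     = zero
  ... | ‵inject₁ j = suc j

  next∘prev : ∀ i → next (prev i) ≡ i
  next∘prev i with view i
  ... | ‵fromℕ     = refl
  ... | ‵inject₁ j = refl

  prev∘next : ∀ i → prev (next i) ≡ i
  prev∘next zero    rewrite view-fromℕ n   = refl
  prev∘next (suc i) rewrite view-inject₁ i = refl

  descend : ∀ k x y → toℕ x ≡ k + toℕ y → Reach next x y
  descend zero    x       y eq with refl ← toℕ-injective eq = ε
  descend (suc k) (suc x) y eq =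
    refl ◅ descend k (inject₁ x) y (trans (toℕ-inject₁ x) (suc-injective eq))

finite-subset : (p : Fin n → Bool) → ∃ λ k → Σ (Fin n) (T ∘ p) ↔ Fin k
finite-subset {zero} p = 0 , mk↔ₛ′ (λ ()) (λ ()) (λ ()) (λ ())
finite-subset {suc n} p with finite-subset (p ∘ suc) | p zero in p₀
... | k , i | true  = suc k , mk↔ₛ′
  (λ { (zero , _) → zero ; (suc j , q) → suc (to i (j , q)) })
  (λ { zero → zero , subst T (sym p₀) tt
     ; (suc l) → suc (proj₁ (from i l)) , proj₂ (from i l) })
  (λ { zero → refl ; (suc l) → cong suc (strictlyInverseˡ i l) })
  (λ { (zero , q) → cong (zero ,_) (T-irrelevant _ q)
     ; (suc j , q) → cong (λ (j , q) → suc j , q) (strictlyInverseʳ i (j , q)) })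
... | k , i | false = k , mk↔ₛ′
  (λ { (zero , q) → contradiction (subst T p₀ q) id ; (suc j , q) → to i (j , q) })
  (λ l → suc (proj₁ (from i l)) , proj₂ (from i l))
  (strictlyInverseˡ i)
  (λ { (zero , q) → contradiction (subst T p₀ q) id
     ; (suc j , q) → cong (λ (j , q) → suc j , q) (strictlyInverseʳ i (j , q)) })

-- The doubling works for every rotation system, so an arbitrary cyclic order of the neighbours
-- serves.
subsetCycle : (p : Fin n → Bool) → Cycle (Σ (Fin n) (T ∘ p))
subsetCycle p = let (k , i) = finite-subset p in transport (↔-sym i) (finCycle k)

-- Counting orbits

-- Invariance makes `class` constant on orbits, and since every element lies in the orbit of its
-- representative, equal classes mean equal orbits.
orbitCount : {f : A → A} (class : A → B) (representative : B → A) →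
  (∀ x → class (f x) ≡ class x) →
  (∀ b → class (representative b) ≡ b) →
  (∀ x → Setoid._≈_ (Orbits f) x (representative (class x))) →
  B ↔ Fin m → OrbitCount f m
orbitCount {f = f} class rep invariant section connected i = record
  { to        = to i ∘ class
  ; cong      = cong (to i) ∘ constant
  ; bijective =
      (λ {x} {y} eq → Setoid.trans (Orbits f) (connected x)
        (Setoid.trans (Orbits f)
          (Setoid.reflexive (Orbits f) (cong rep (Injection.injective (↔⇒↣ i) eq)))
          (Setoid.sym (Orbits f) (connected y)))) ,
      (λ k → rep (from i k) , λ z≈ → trans (cong (to i) (trans (constant z≈) (section _)))
        (strictlyInverseˡ i k))
  }
  where
  constant : ∀ {x y} → Setoid._≈_ (Orbits f) x y → class x ≡ class y
  constant ε                = refl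
  constant (fwd refl ◅ x≈y) = trans (sym (invariant _)) (constant x≈y)
  constant (bwd refl ◅ x≈y) = trans (invariant _) (constant x≈y)

-- Lets the orbits of `opposite` and `traceFace` be counted in coordinates where both have explicit
-- formulas.
conjugateOrbitCount : {f : A → A} {h : B → B} (i : A ↔ B) →
  (∀ x → to i (f x) ≡ h (to i x)) → OrbitCount h m → OrbitCount f m
conjugateOrbitCount {f = f} {h} i commutes count = record
  { to        = Bijection.to count ∘ to i
  ; cong      = Bijection.cong count ∘ forth
  ; bijective =
      (λ {x} {y} eq → subst₂ (Setoid._≈_ (Orbits f)) (strictlyInverseʳ i x) (strictlyInverseʳ i y)
        (back (Bijection.injective count eq))) ,
      (λ k → let (b , eq) = Bijection.surjective count k in
        from i b , λ z≈ → eq (subst (Setoid._≈_ (Orbits h) _) (strictlyInverseˡ i b) (forth z≈)))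
  }
  where
  forth : ∀ {x y} → Setoid._≈_ (Orbits f) x y → Setoid._≈_ (Orbits h) (to i x) (to i y)
  forth = EqClosure.gmap (to i) λ { refl → commutes _ }

  back : ∀ {x y} → Setoid._≈_ (Orbits h) x y → Setoid._≈_ (Orbits f) (from i x) (from i y)
  back = EqClosure.gmap (from i) λ {x} → λ { refl →
    Injection.injective (↔⇒↣ i) (trans (strictlyInverseˡ i _)
      (sym (trans (commutes _) (cong h (strictlyInverseˡ i x))))) }

-- Darts and edges

dart-≡ : {G : Graph n} {d e : Dart G} →
  Dart.tail d ≡ Dart.tail e → Dart.head d ≡ Dart.head e → d ≡ e
dart-≡ {d = dart u v _} refl refl = cong (dart u v) (T-irrelevant _ _)

opposite-involutive : {G : Graph n} (d : Dart G) → opposite (opposite d) ≡ d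
opposite-involutive _ = dart-≡ refl refl

-- Each edge is represented by its dart with the smaller tail.
Edge : Graph n → Set
Edge G = Σ (Dart G) λ d → Dart.tail d Fin.< Dart.head d

flip : Fin 2 → Fin 2
flip 0F = 1F
flip 1F = 0F

unorient : {G : Graph n} → Edge G × Fin 2 → Dart G
unorient ((d , _) , 0F) = d
unorient ((d , _) , 1F) = opposite d

orient : {G : Graph n} → Dart G → Edge G × Fin 2
orient {G = G} d with <-cmp (Dart.tail d) (Dart.head d)
... | tri< lt _ _ = (d , lt) , 0F
... | tri≈ _ eq _ = contradiction (Dart.adjacent d) (Graph.loopless G eq)
... | tri> _ _ gt = (opposite d , gt) , 1F

edge-≡ : {G : Graph n} {e e′ : Edge G} → proj₁ e ≡ proj₁ e′ → e ≡ e′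
edge-≡ {e = d , p} {_ , q} refl = cong (d ,_) (≤-irrelevant p q)

dart↔ : {G : Graph n} → Dart G ↔ (Edge G × Fin 2)
dart↔ {G = G} = mk↔ₛ′ orient unorient
  (λ { (e , 0F) → orient-edge e ; (e , 1F) → orient-opposite e }) unorient-orient
  where
  orient-edge : ∀ e → orient {G = G} (unorient (e , 0F)) ≡ (e , 0F)
  orient-edge (d , lt) with <-cmp (Dart.tail d) (Dart.head d)
  ... | tri< _ _ _  = cong (_, 0F) (edge-≡ refl)
  ... | tri≈ _ eq _ = contradiction (Dart.adjacent d) (Graph.loopless G eq)
  ... | tri> ≮ _ _  = contradiction lt ≮

  orient-opposite : ∀ e → orient {G = G} (unorient (e , 1F)) ≡ (e , 1F)
  orient-opposite (d , lt) with <-cmp (Dart.head d) (Dart.tail d)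
  ... | tri< _ _ ≯ = contradiction lt ≯
  ... | tri≈ _ eq _ = contradiction (Dart.adjacent d) (Graph.loopless G (sym eq))
  ... | tri> _ _ _ = cong (_, 1F) (edge-≡ (opposite-involutive d))

  unorient-orient : ∀ d → unorient (orient {G = G} d) ≡ d
  unorient-orient d with <-cmp (Dart.tail d) (Dart.head d)
  ... | tri< _ _ _  = refl
  ... | tri≈ _ eq _ = contradiction (Dart.adjacent d) (Graph.loopless G eq)
  ... | tri> _ _ _  = opposite-involutive d

-- By `dart↔` only darts of the form `unorient (e , b)` need checking, and there reversal visibly
-- flips `b`; the ends need not be compared again.
orient-flip : {G : Graph n} (d : Dart G) →
  let (e , b) = orient d in orient (opposite d) ≡ (e , flip b)
orient-flip {G = G} d =
  subst (λ d → orient (opposite d) ≡ flip₂ (orient d)) (strictlyInverseʳ dart↔ d)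
    (helper (orient d))
  where
  flip₂ : Edge G × Fin 2 → Edge G × Fin 2
  flip₂ (e , b) = e , flip b

  helper : ∀ x → orient (opposite (unorient {G = G} x)) ≡ flip₂ (orient (unorient x))
  helper x@(e , 0F) = trans (strictlyInverseˡ dart↔ (e , 1F))
    (sym (cong flip₂ (strictlyInverseˡ dart↔ x)))
  helper x@(e , 1F) = trans (cong orient (opposite-involutive (proj₁ e)))
    (trans (strictlyInverseˡ dart↔ (e , 0F))
      (sym (cong flip₂ (strictlyInverseˡ dart↔ x))))

neighbour-≡ : (G : Graph n) {u : Fin n} {v w : Graph.Neighbour G u} →
  proj₁ v ≡ proj₁ w → v ≡ w
neighbour-≡ G refl = cong (_ ,_) (T-irrelevant _ _)

-- Euler's formula

euler⁺ : ∀ n E F g → n + F + 2 * g ≡ 2 + E →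
  + n ℤ.- + E ℤ.+ + F ≡ + 2 ℤ.- + (2 * g)
euler⁺ n E F g eq = begin
  + n ℤ.- + E ℤ.+ + F                                  ≡⟨ rearrange₁ (+ n) (+ E) (+ F) (+ (2 * g)) ⟩
  + (n + F + 2 * g) ℤ.- (+ E ℤ.+ + (2 * g))            ≡⟨ cong (λ x → + x ℤ.- (+ E ℤ.+ + (2 * g))) eq ⟩
  + (2 + E) ℤ.- (+ E ℤ.+ + (2 * g))                    ≡⟨ rearrange₂ (+ 2) (+ E) (+ (2 * g)) ⟩
  + 2 ℤ.- + (2 * g)                                    ∎
  where
  open ≡-Reasoning
  rearrange₁ : ∀ n E F G → n ℤ.- E ℤ.+ F ≡ n ℤ.+ F ℤ.+ G ℤ.- (E ℤ.+ G)
  rearrange₁ = ℤ-Solver.solve-∀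
  rearrange₂ : ∀ t E G → t ℤ.+ E ℤ.- (E ℤ.+ G) ≡ t ℤ.- G
  rearrange₂ = ℤ-Solver.solve-∀

euler⁻ : ∀ n E F g → + n ℤ.- + E ℤ.+ + F ≡ + 2 ℤ.- + (2 * g) →
  n + F + 2 * g ≡ 2 + E
euler⁻ n E F g eq = ℤ.+-injective (begin
  + (n + F + 2 * g)                                    ≡⟨ rearrange₁ (+ n) (+ E) (+ F) (+ (2 * g)) ⟩
  (+ n ℤ.- + E ℤ.+ + F) ℤ.+ (+ E ℤ.+ + (2 * g))        ≡⟨ cong (ℤ._+ (+ E ℤ.+ + (2 * g))) eq ⟩
  (+ 2 ℤ.- + (2 * g)) ℤ.+ (+ E ℤ.+ + (2 * g))          ≡⟨ rearrange₂ (+ 2) (+ E) (+ (2 * g)) ⟩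
  + (2 + E)                                            ∎)
  where
  open ≡-Reasoning
  rearrange₁ : ∀ n E F G → n ℤ.+ F ℤ.+ G ≡ (n ℤ.- E ℤ.+ F) ℤ.+ (E ℤ.+ G)
  rearrange₁ = ℤ-Solver.solve-∀
  rearrange₂ : ∀ t E G → (t ℤ.- G) ℤ.+ (E ℤ.+ G) ≡ t ℤ.+ E
  rearrange₂ = ℤ-Solver.solve-∀

-- Doubling the vertices

module Doubling {c : ℕ} (G : Graph c) where

  open Graph G using (Adj; Neighbour)

  side : Fin (2 * c) → Fin 2
  side = proj₁ ∘ remQuot {2} c

  base : Fin (2 * c) → Fin c
  base = proj₂ ∘ remQuot {2} c

  side-combine : ∀ s (v : Fin c) → side (combine s v) ≡ s
  side-combine s v = cong proj₁ (remQuot-combine s v)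

  base-combine : ∀ (s : Fin 2) v → base (combine s v) ≡ v
  base-combine s v = cong proj₂ (remQuot-combine s v)

  -- The lexicographic product of `G` with two isolated vertices. Adjacency ignores sides, so
  -- looplessness of `G` keeps the two copies of a vertex apart.
  doubled : Graph (2 * c)
  doubled = record
    { adj       = λ x y → Graph.adj G (base x) (base y)
    ; loopless  = λ eq → Graph.loopless G (cong base eq)
    ; symmetric = Graph.symmetric G
    }

  doubled-connected : Graph.Connected G → (∀ u → Neighbour u) → Graph.Connected doubled
  doubled-connected connected neighbour x y =
    subst₂ (Star (Graph.Adj doubled)) (combine-remQuot {2} c x) (combine-remQuot {2} c y)
      (lift (side x) (side y) (connected (base x) (base y)))
    where
    edge : ∀ s t {u v} → Adj u v → Graph.Adj doubled (combine s u) (combine t v)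
    edge s t {u} {v} = subst₂ Adj (sym (base-combine s u)) (sym (base-combine t v))

    lift : ∀ s t {u v} → Star Adj u v → Star (Graph.Adj doubled) (combine s u) (combine t v)
    -- Copies of one vertex are not adjacent, so the path between them detours through a neighbour.
    lift s t {u} ε    = let (w , uw) = neighbour u in
      edge s 0F uw ◅ edge 0F t (Graph.symmetric G uw) ◅ ε
    lift s t (uw ◅ p) = edge s 0F uw ◅ lift 0F t p

  neighbour↔ : ∀ x → Graph.Neighbour doubled x ↔ (Neighbour (base x) × Fin 2)
  neighbour↔ x = mk↔ₛ′
    (λ (y , xy) → (base y , xy) , side y)
    (λ ((v , uv) , t) → combine t v , subst (Adj (base x)) (sym (base-combine t v)) uv)
    (λ ((v , _) , t) → cong₂ _,_ (neighbour-≡ G (base-combine t v)) (side-combine t v))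
    (λ (y , _) → neighbour-≡ doubled (combine-remQuot {2} c y))

  -- The side of the tail comes first, then the side of the head.
  SidedDart : Set
  SidedDart = Dart G × Fin 2 × Fin 2

  sided : Dart doubled → SidedDart
  sided (dart x y xy) = dart (base x) (base y) xy , side x , side y

  sided↔ : Dart doubled ↔ SidedDart
  sided↔ = mk↔ₛ′ sided
    (λ (dart u v uv , s , t) → dart (combine s u) (combine t v)
      (subst₂ Adj (sym (base-combine s u)) (sym (base-combine t v)) uv))
    (λ (dart u v uv , s , t) → cong₂ _,_ (dart-≡ (base-combine s u) (base-combine t v))
      (cong₂ _,_ (side-combine s u) (side-combine t v)))
    (λ (dart x y _) → dart-≡ (combine-remQuot {2} c x) (combine-remQuot {2} c y))

  -- An edge of `G` has four lifts, one for each choice of sides at its two ends; `class` swaps the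
  -- sides of a reversed dart so that the smaller end is always listed first.
  doubled-edgeCount : Edge G ↔ Fin m → OrbitCount (opposite {G = doubled}) (m * (2 * 2))
  doubled-edgeCount i =
    conjugateOrbitCount ((dart↔ ×-↔ ↔-id _) ↔-∘ sided↔)
      (λ (dart x y xy) → cong (_, (side y , side x)) (orient-flip (dart (base x) (base y) xy)))
      (orbitCount {f = reverse} class (λ (e , st) → (e , 0F) , st)
        (λ { ((e , 0F) , _) → refl ; ((e , 1F) , _) → refl })
        (λ _ → refl)
        (λ { ((e , 0F) , _) → ε ; ((e , 1F) , _) → fwd refl ◅ ε })
        (↔-sym *↔× ↔-∘ (i ×-↔ ↔-sym *↔×)))
    where
    reverse : (Edge G × Fin 2) × Fin 2 × Fin 2 → (Edge G × Fin 2) × Fin 2 × Fin 2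
    reverse ((e , b) , s , t) = (e , flip b) , t , s

    class : (Edge G × Fin 2) × Fin 2 × Fin 2 → Edge G × Fin 2 × Fin 2
    class ((e , 0F) , s , t) = e , s , t
    class ((e , 1F) , s , t) = e , t , s

  -- Rotation system and faces of the doubled graph.

  module _ (cycle : ∀ v → Cycle (Neighbour v)) where

    turn turn⁻¹ : Dart G → Dart G
    turn   (dart u v uv) = let (w , uw) = to   (permutation (cycle u)) (v , uv) in dart u w uw
    turn⁻¹ (dart u v uv) = let (w , uw) = from (permutation (cycle u)) (v , uv) in dart u w uw

    turn-turn⁻¹ : ∀ d → turn (turn⁻¹ d) ≡ d
    turn-turn⁻¹ (dart u v uv) =
      cong (λ (w , uw) → dart u w uw) (strictlyInverseˡ (permutation (cycle u)) (v , uv))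

    turn⁻¹-turn : ∀ d → turn⁻¹ (turn d) ≡ d
    turn⁻¹-turn (dart u v uv) =
      cong (λ (w , uw) → dart u w uw) (strictlyInverseʳ (permutation (cycle u)) (v , uv))

    orientation : Fin 2 → Cycle A → Cycle A
    orientation 0F = id
    orientation 1F = inverse

    doubledCycle : ∀ x → Cycle (Graph.Neighbour doubled x)
    doubledCycle x = transport (↔-sym (neighbour↔ x))
      (orientation (side x) (interleave (cycle (base x))))

    doubledEmbedding : RotationSystem doubled
    doubledEmbedding = record
      { next   = to ∘ permutation ∘ doubledCycle
      ; cyclic = cyclicPermutation ∘ doubledCycle
      }

    open RotationSystem doubledEmbedding

    -- Face tracing in sided coordinates: the base neighbour changes only when the interleaved order
    -- passes from one pair of copies to another, forwards around side 0 and backwards around side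
    -- 1.
    trace : SidedDart → SidedDart
    trace (d , 0F , 0F) = opposite d , 0F , 1F
    trace (d , 1F , 0F) = turn (opposite d) , 0F , 0F
    trace (d , 0F , 1F) = turn⁻¹ (opposite d) , 1F , 1F
    trace (d , 1F , 1F) = opposite d , 1F , 0F

    sided-traceFace : ∀ d → sided (traceFace d) ≡ trace (sided d)
    sided-traceFace (dart x y xy) = trans
      -- The conjugation by `neighbour↔` inside `doubledCycle` cancels; what remains computes for
      -- each choice of sides.
      (cong (λ ((w , yw) , t) → dart (base y) w yw , side y , t)
        (strictlyInverseˡ (neighbour↔ y)
          (to (permutation (orientation (side y) (interleave (cycle (base y)))))
            ((base x , Graph.symmetric G xy) , side x))))
      (helper (side x) (side y))
      where
      helper : ∀ s t →
        (let ((w , yw) , r) = to (permutation (orientation t (interleave (cycle (base y)))))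
                                ((base x , Graph.symmetric G xy) , s)
         in dart (base y) w yw , t , r) ≡ trace (dart (base x) (base y) xy , s , t)
      helper 0F 0F = refl
      helper 0F 1F = refl
      helper 1F 0F = refl
      helper 1F 1F = refl

    -- The face inserted in the corner of G at u between v and its successor w is
    -- the cycle (u , 1) (v , 1) (u , 0) (w , 0); it is named after the dart u → v.
    face : SidedDart → Dart G
    face (d , 0F , 0F) = turn⁻¹ d
    face (d , 1F , 0F) = opposite d
    face (d , 0F , 1F) = turn⁻¹ (opposite d)
    face (d , 1F , 1F) = d

    face-trace : ∀ x → face (trace x) ≡ face x
    face-trace (d , 0F , 0F) = cong turn⁻¹ (opposite-involutive d)
    face-trace (d , 1F , 0F) = turn⁻¹-turn (opposite d)
    face-trace (d , 0F , 1F) = refl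
    face-trace (d , 1F , 1F) = opposite-involutive d

    -- Tracing runs through the sides 11, 10, 00, 01 cyclically, so 11 is reached within three
    -- steps, and there `face` is the dart itself.
    face-connected : ∀ x → Setoid._≈_ (Orbits trace) x (face x , 1F , 1F)
    face-connected = λ
      { (d , 0F , 0F) → later _ (via₀₁ _)
      ; (d , 1F , 0F) → later _ (later _ (via₀₁ _))
      ; (d , 0F , 1F) → via₀₁ d
      ; (d , 1F , 1F) → ε }
      where
      later : ∀ x → Setoid._≈_ (Orbits trace) (trace x) (face (trace x) , 1F , 1F) →
        Setoid._≈_ (Orbits trace) x (face x , 1F , 1F)
      later x r =
        fwd refl ◅
        subst (λ d → Setoid._≈_ (Orbits trace) (trace x) (d , 1F , 1F)) (face-trace x) r

      via₀₁ : ∀ d → Setoid._≈_ (Orbits trace) (d , 0F , 1F) (face (d , 0F , 1F) , 1F , 1F)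
      via₀₁ d = fwd refl ◅ ε

    doubled-faceCount : Edge G ↔ Fin m → OrbitCount traceFace (m * 2)
    doubled-faceCount i =
      conjugateOrbitCount sided↔ sided-traceFace
        (orbitCount face (_, (1F , 1F)) face-trace (λ _ → refl) face-connected
          (↔-sym *↔× ↔-∘ ((i ×-↔ ↔-id _) ↔-∘ dart↔)))

    -- One round through the four side patterns performs one `turn` and one `turn⁻¹`, which cancel
    -- along with the reversals.
    trace⁴ : ∀ x → iterate trace x 4 ≡ x
    trace⁴ (d , 0F , 0F) = cong (_, (0F , 0F)) (trans
      (cong turn (trans (opposite-involutive _) (cong turn⁻¹ (opposite-involutive d)))) (turn-turn⁻¹ d))
    trace⁴ (d , 1F , 0F) = cong (_, (1F , 0F)) (trans
      (cong opposite (trans (cong turn⁻¹ (opposite-involutive _)) (turn⁻¹-turn _))) (opposite-involutive d))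
    trace⁴ (d , 0F , 1F) = cong (_, (0F , 1F)) (trans
      (cong opposite (trans (cong turn (opposite-involutive _)) (turn-turn⁻¹ _))) (opposite-involutive d))
    trace⁴ (d , 1F , 1F) = cong (_, (1F , 1F)) (trans
      (cong turn⁻¹ (trans (opposite-involutive _) (cong turn (opposite-involutive d)))) (turn⁻¹-turn d))

    sided-iterate : ∀ d k → sided (iterate traceFace d k) ≡ iterate trace (sided d) k
    sided-iterate d zero    = refl
    sided-iterate d (suc k) =
      trans (sided-iterate (traceFace d) k) (cong (λ x → iterate trace x k) (sided-traceFace d))

    traceFace⁴ : ∀ d → iterate traceFace d 4 ≡ d
    traceFace⁴ d =
      Injection.injective (↔⇒↣ sided↔) (trans (sided-iterate d 4) (trace⁴ (sided d)))

    -- This separates opposite corners of a face even when they are copies of one vertex, as always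
    -- for one diagonal, and for both at a vertex of degree one.
    trace²-side : ∀ x → proj₁ (proj₂ (trace (trace x))) ≢ proj₁ (proj₂ x)
    trace²-side (d , 0F , 0F) ()
    trace²-side (d , 1F , 0F) ()
    trace²-side (d , 0F , 1F) ()
    trace²-side (d , 1F , 1F) ()

    traceFace²-tail : ∀ d → Dart.tail (traceFace (traceFace d)) ≢ Dart.tail d
    traceFace²-tail d eq = trace²-side (sided d)
      (trans (sym (cong (proj₁ ∘ proj₂) (sided-iterate d 2))) (cong side eq))

    -- Consecutive corners differ by looplessness, opposite ones by their sides; this covers all six
    -- pairs.
    doubled-quadrilateral : ∀ d → BoundedBy4Cycle d
    doubled-quadrilateral d = traceFace⁴ d , injective _ _
      where
      edge : ∀ d → Dart.tail d ≢ Dart.tail (traceFace d)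
      edge d eq = Graph.loopless doubled eq (Dart.adjacent d)

      diagonal : ∀ d → Dart.tail d ≢ Dart.tail (traceFace (traceFace d))
      diagonal d = traceFace²-tail d ∘ sym

      edge₃ : Dart.tail (iterate traceFace d 3) ≢ Dart.tail d
      edge₃ eq = edge (iterate traceFace d 3) (trans eq (cong Dart.tail (sym (traceFace⁴ d))))

      injective : ∀ (i j : Fin 4) → Dart.tail (iterate traceFace d (toℕ i)) ≡
        Dart.tail (iterate traceFace d (toℕ j)) → i ≡ j
      injective 0F 0F _  = refl
      injective 0F 1F eq = contradiction eq (edge d)
      injective 0F 2F eq = contradiction eq (diagonal d)
      injective 0F 3F eq = contradiction (sym eq) edge₃
      injective 1F 0F eq = contradiction (sym eq) (edge d)
      injective 1F 1F _  = refl
      injective 1F 2F eq = contradiction eq (edge (traceFace d))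
      injective 1F 3F eq = contradiction eq (diagonal (traceFace d))
      injective 2F 0F eq = contradiction (sym eq) (diagonal d)
      injective 2F 1F eq = contradiction (sym eq) (edge (traceFace d))
      injective 2F 2F _  = refl
      injective 2F 3F eq = contradiction eq (edge (iterate traceFace d 2))
      injective 3F 0F eq = contradiction eq edge₃
      injective 3F 1F eq = contradiction (sym eq) (diagonal (traceFace d))
      injective 3F 2F eq = contradiction (sym eq) (edge (iterate traceFace d 2))
      injective 3F 3F _  = refl

  -- With 2c vertices, 4m edges and 2m faces, Euler's formula is twice the equation c + g = m + 1.
  doubledQuadrangulation : ∀ {g} → Graph.Connected G → (∀ u → Neighbour u) → Dart G →
    Edge G ↔ Fin m → c + g ≡ suc m → Quadrangulation g (2 * c)
  doubledQuadrangulation {m} {g} connected neighbour d i eq = record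
    { skeleton      = doubled
    ; connected     = doubled-connected connected neighbour
    ; someDart      = from sided↔ (d , 0F , 0F)
    ; embedding     = doubledEmbedding cycle
    ; genus         = m * (2 * 2) , m * 2 , doubled-edgeCount i , doubled-faceCount cycle i ,
        euler⁺ (2 * c) (m * (2 * 2)) (m * 2) g (begin
          2 * c + m * 2 + 2 * g  ≡⟨ lhs c m g ⟩
          2 * (c + g) + m * 2    ≡⟨ cong (λ x → 2 * x + m * 2) eq ⟩
          2 * suc m + m * 2      ≡⟨ rhs m ⟩
          2 + m * (2 * 2)        ∎)
    ; quadrilateral = doubled-quadrilateral cycle
    }
    where
    open ≡-Reasoning
    cycle : ∀ v → Cycle (Neighbour v)
    cycle v = subsetCycle (Graph.adj G v)
    lhs : ∀ c m g → 2 * c + m * 2 + 2 * g ≡ 2 * (c + g) + m * 2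
    lhs = solve-∀
    rhs : ∀ m → 2 * suc m + m * 2 ≡ 2 + m * (2 * 2)
    rhs = solve-∀

-- Graphs with prescribed numbers of vertices and edges

-- The edges are the first k pairs {i < j} in lexicographic order.
initialAdj : (n k : ℕ) → Fin n → Fin n → Bool
initialAdj (suc n) k zero    zero    = false
initialAdj (suc n) k zero    (suc j) = toℕ j <ᵇ k
initialAdj (suc n) k (suc i) zero    = toℕ i <ᵇ k
initialAdj (suc n) k (suc i) (suc j) = initialAdj n (k ∸ n) i j

initialGraph : (n k : ℕ) → Graph n
initialGraph n k = record
  { adj       = initialAdj n k
  ; loopless  = λ { refl → loopless n k _ }
  ; symmetric = λ {u} {v} → symmetric n k u v
  }
  where
  loopless : ∀ n k u → T (initialAdj n k u u) → ⊥
  loopless (suc n) k (suc u) = loopless n (k ∸ n) u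

  symmetric : ∀ n k u v → T (initialAdj n k u v) → T (initialAdj n k v u)
  symmetric (suc n) k zero    (suc v) = id
  symmetric (suc n) k (suc u) zero    = id
  symmetric (suc n) k (suc u) (suc v) = symmetric n (k ∸ n) u v

-- The binomial coefficient n(n - 1)/2, the number of pairs of vertices, rather than n(n + 1)/2.
triangle : ℕ → ℕ
triangle zero    = 0
triangle (suc n) = n + triangle n

triangle-suc*2 : ∀ n → triangle (suc n) * 2 ≡ suc n * n
triangle-suc*2 zero    = refl
triangle-suc*2 (suc n) = begin
  (suc n + triangle (suc n)) * 2   ≡⟨ *-distribʳ-+ 2 (suc n) (triangle (suc n)) ⟩
  suc n * 2 + triangle (suc n) * 2 ≡⟨ cong (λ t → suc n * 2 + t) (triangle-suc*2 n) ⟩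
  suc n * 2 + suc n * n            ≡⟨ rearrange n ⟩
  suc (suc n) * suc n              ∎
  where
  open ≡-Reasoning
  rearrange : ∀ n → suc n * 2 + suc n * n ≡ suc (suc n) * suc n
  rearrange = solve-∀

below↔ : ∀ n k → Σ (Fin n) (λ j → T (toℕ j <ᵇ k)) ↔ Fin (n ⊓ k)
below↔ zero    k       = mk↔ₛ′ (λ ()) (λ ()) (λ ()) (λ ())
below↔ (suc n) zero    = mk↔ₛ′ (λ ()) (λ ()) (λ ()) (λ ())
below↔ (suc n) (suc k) = mk↔ₛ′
  (λ { (zero , _) → zero ; (suc j , p) → suc (to (below↔ n k) (j , p)) })
  (λ { zero → zero , tt ; (suc l) → let (j , p) = from (below↔ n k) l in suc j , p })
  (λ { zero → refl ; (suc l) → cong suc (strictlyInverseˡ (below↔ n k) l) })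
  (λ { (zero , _) → refl
     ; (suc j , p) → cong (λ (j , p) → suc j , p) (strictlyInverseʳ (below↔ n k) (j , p)) })

-- Vertex 0 is the smaller end of `n ⊓ k` edges and the other vertices span `k ∸ n`, which add up to
-- `k`.
initialEdge↔ : ∀ n k → k ≤ triangle n → Edge (initialGraph n k) ↔ Fin k
initialEdge↔ zero    .0 z≤n = mk↔ₛ′ (λ ()) (λ ()) (λ ()) (λ ())
initialEdge↔ (suc n) k  k≤  =
  subst (λ l → Edge (initialGraph (suc n) k) ↔ Fin l) (m⊓n+n∸m≡n n k)
    (↔-sym +↔⊎ ↔-∘ ((below↔ n k ⊎-↔ initialEdge↔ n (k ∸ n) (m≤n+o⇒m∸n≤o k n k≤)) ↔-∘ split))
  where
  split : Edge (initialGraph (suc n) k) ↔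
    (Σ (Fin n) (λ j → T (toℕ j <ᵇ k)) ⊎ Edge (initialGraph n (k ∸ n)))
  split = mk↔ₛ′
    (λ { (dart zero (suc j) p , _) → inj₁ (j , p)
       ; (dart (suc i) (suc j) p , s≤s lt) → inj₂ (dart i j p , lt) })
    (λ { (inj₁ (j , p)) → dart zero (suc j) p , s≤s z≤n
       ; (inj₂ (dart i j p , lt)) → dart (suc i) (suc j) p , s≤s lt })
    (λ { (inj₁ _) → refl ; (inj₂ _) → refl })
    (λ { (dart zero (suc j) p , s≤s z≤n) → refl ; (dart (suc i) (suc j) p , s≤s lt) → refl })

-- For c = q + 2 the required number of edges is c - 1 + g. The first c - 1 pairs form a star at
-- vertex 0, so the graph is connected without isolated vertices, and the bound on `g` leaves room
-- for the other edges.
quadrangulation : ∀ q g → g ≤ triangle (suc q) → Quadrangulation g (2 * (2 + q))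
quadrangulation q g g≤ =
  Doubling.doubledQuadrangulation G connected neighbour (dart zero (suc zero) (hub zero))
    (initialEdge↔ (2 + q) (suc q + g) (+-monoʳ-≤ (suc q) g≤)) refl
  where
  G = initialGraph (2 + q) (suc q + g)

  hub : ∀ j → Graph.Adj G zero (suc j)
  hub j = <⇒<ᵇ (≤-trans (toℕ<n j) (m≤m+n (suc q) g))

  neighbour : ∀ u → Graph.Neighbour G u
  neighbour zero    = suc zero , hub zero
  neighbour (suc j) = zero , hub j

  connected : Graph.Connected G
  connected zero    zero    = ε
  connected zero    (suc v) = hub v ◅ ε
  connected (suc u) zero    = hub u ◅ ε
  connected (suc u) (suc v) = _◅_ {j = zero} (hub u) (hub v ◅ ε)

-- The lower bound

module LowerBound {g n} (Q : Quadrangulation g n) where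

  open Quadrangulation Q

  ↣⇒≤ : ∀ {k l} → Fin k ↣ Fin l → k ≤ l
  ↣⇒≤ i = injective⇒≤ (Injection.injective i)

  tail≢head : ∀ (d : Dart skeleton) → Dart.tail d ≢ Dart.head d
  tail≢head d eq = Graph.loopless skeleton eq (Dart.adjacent d)

  -- A chosen dart of each edge and its reverse are distinct, so there are at least 2E darts.
  edges↣darts : ∀ {E} → OrbitCount (opposite {G = skeleton}) E → Fin (E * 2) ↣ Dart skeleton
  edges↣darts {E} count = mk↣ {to = pick} (injective _ _) ↣-∘ ↔⇒↣ *↔×
    where
    open Bijection count using () renaming (to to class; cong to class-cong; surjective to surj)

    rep : Fin E → Dart skeleton
    rep e = proj₁ (surj e)

    pick : Fin E × Fin 2 → Dart skeleton
    pick (e , 0F) = rep e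
    pick (e , 1F) = opposite (rep e)

    class-pick : ∀ x → class (pick x) ≡ proj₁ x
    class-pick (e , 0F) = proj₂ (surj e) ε
    class-pick (e , 1F) = proj₂ (surj e) (bwd refl ◅ ε)

    injective : ∀ x y → pick x ≡ pick y → x ≡ y
    injective x@(e , s) y@(_ , t) eq
      with refl ← trans (sym (class-pick x)) (trans (cong class eq) (class-pick y))
      = cong (e ,_) (sides s t eq)
      where
      sides : ∀ s t → pick (e , s) ≡ pick (e , t) → s ≡ t
      sides 0F 0F _  = refl
      sides 0F 1F eq = contradiction (cong Dart.tail eq) (tail≢head (rep e))
      sides 1F 0F eq = contradiction (cong Dart.head eq) (tail≢head (rep e))
      sides 1F 1F _  = refl

  -- A dart is recovered from its face and its position among the four steps from the chosen dart of
  -- that face, so there are at most 4F darts.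
  darts↣faces : ∀ {F} → OrbitCount traceFace F → Dart skeleton ↣ Fin (F * 4)
  darts↣faces {F} count = ↔⇒↣ (↔-sym *↔×) ↣-∘ mk↣ {to = λ d → class d , proj₁ (position d)}
    (λ {d} {e} eq → trans (proj₂ (position d))
      (trans (cong (λ (f , i) → iterate traceFace (rep f) (toℕ i)) eq) (sym (proj₂ (position e)))))
    where
    open Bijection count using () renaming (to to class; injective to class-injective; surjective to surj)

    rep : Fin F → Dart skeleton
    rep f = proj₁ (surj f)

    Position : Dart skeleton → Dart skeleton → Set
    Position d e = ∃ λ (i : Fin 4) → e ≡ iterate traceFace d (toℕ i)

    forward : ∀ {d e} → Position d e → Position d (traceFace e)
    forward (0F , refl) = 1F , refl
    forward (1F , refl) = 2F , refl
    forward (2F , refl) = 3F , refl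
    forward (3F , refl) = 0F , proj₁ (quadrilateral _)

    -- As the fourth power of `traceFace` is the identity, its cube undoes one step.
    backward : ∀ {d e} → Position d (traceFace e) → Position d e
    backward {d} {e} p =
      subst (Position d) (proj₁ (quadrilateral e)) (forward (forward (forward p)))

    extend : ∀ {d e e′} → Position d e → Setoid._≈_ (Orbits traceFace) e e′ → Position d e′
    extend p ε              = p
    extend p (fwd refl ◅ r) = extend (forward p) r
    extend p (bwd refl ◅ r) = extend (backward p) r

    position : ∀ d → Position (rep (class d)) d
    position d = extend (0F , refl) (class-injective (proj₂ (surj (class d)) ε))

  -- Simplicity enters here: a dart is determined by its tail and one of the `n ∸ 1` other vertices.
  darts↣pairs : Dart skeleton ↣ Fin (n * (n ∸ 1))
  darts↣pairs = ↔⇒↣ (↔-sym *↔×) ↣-∘ helper skeleton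
    where
    helper : ∀ {n} (G : Graph n) → Dart G ↣ (Fin n × Fin (n ∸ 1))
    helper {zero}  G = mk↣ {to = λ { (dart () _ _) }} (λ { {dart () _ _} })
    helper {suc n} G = mk↣
      {to = λ (dart u v uv) → u , punchOut {i = u} {v} (λ eq → Graph.loopless G eq uv)}
      (λ {d} {e} eq → injective d e (cong proj₁ eq) (cong proj₂ eq))
      where
      injective : ∀ (d e : Dart G) → Dart.tail d ≡ Dart.tail e →
        punchOut (λ eq → Graph.loopless G eq (Dart.adjacent d)) ≡
        punchOut (λ eq → Graph.loopless G eq (Dart.adjacent e)) → d ≡ e
      injective (dart u v uv) (dart .u w uw) refl eq = dart-≡ refl
        (punchOut-injective (λ eq → Graph.loopless G eq uv) (λ eq → Graph.loopless G eq uw) eq)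

  -- Four times Euler's formula is 4n + 4F + 8g = 8 + 4E. Insert 2E ≤ 4F, then 2E ≤ n(n - 1).
  vertexBound : 4 * n + 8 * g ≤ 8 + n * (n ∸ 1)
  vertexBound with (E , F , edges , faces , euler) ← genus =
    ≤-trans (+-cancelʳ-≤ (E * 2) (4 * n + 8 * g) (8 + E * 2) (begin
      4 * n + 8 * g + E * 2      ≤⟨ +-monoʳ-≤ (4 * n + 8 * g)
                                       (↣⇒≤ (darts↣faces faces ↣-∘ edges↣darts edges)) ⟩
      4 * n + 8 * g + F * 4      ≡⟨ lhs n F g ⟩
      4 * (n + F + 2 * g)        ≡⟨ cong (4 *_) (euler⁻ n E F g euler) ⟩
      4 * (2 + E)                ≡⟨ rhs E ⟩
      8 + E * 2 + E * 2          ∎))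
      (+-monoʳ-≤ 8 (↣⇒≤ (darts↣pairs ↣-∘ edges↣darts edges)))
    where
    open ≤-Reasoning
    lhs : ∀ n F g → 4 * n + 8 * g + F * 4 ≡ 4 * (n + F + 2 * g)
    lhs = solve-∀
    rhs : ∀ E → 4 * (2 + E) ≡ 8 + E * 2 + E * 2
    rhs = solve-∀

-- Arithmetic of the ceiling and floor conditions.

-- With c = q + 2, the square (2c - 3)² equals 8 · (c - 1)(c - 2)/2 + 1.
≤-triangle : ∀ g q → 8 * g + 1 ≤ (2 * (2 + q) ∸ 3) ^ 2 → g ≤ triangle (suc q)
≤-triangle g q h = *-cancelˡ-≤ 8 (+-cancelʳ-≤ 1 _ _ (begin
  8 * g + 1                      ≤⟨ h ⟩
  (2 * (2 + q) ∸ 3) ^ 2          ≡⟨ cong (λ x → (x ∸ 3) ^ 2) (double q) ⟩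
  (2 * q + 1) ^ 2                ≡⟨ square q ⟩
  4 * (suc q * q) + 1            ≡⟨ cong (λ x → 4 * x + 1) (triangle-suc*2 q) ⟨
  4 * (triangle (suc q) * 2) + 1 ≡⟨ scale (triangle (suc q)) ⟩
  8 * triangle (suc q) + 1       ∎))
  where
  open ≤-Reasoning
  double : ∀ q → 2 * (2 + q) ≡ 3 + (2 * q + 1)
  double = solve-∀
  square : ∀ q → (2 * q + 1) * ((2 * q + 1) * 1) ≡ 4 * (suc q * q) + 1
  square = solve-∀
  scale : ∀ t → 4 * (t * 2) + 1 ≡ 8 * t + 1
  scale = solve-∀

-- With n = r + 3 the hypotheses read 32 g ≤ (2 n − 5)² + 7 and (4 c − 7)² ≤ 32 g − 15,
-- while n < 2 c gives 2 n − 5 ≤ 4 c − 7.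
enoughVertices : ∀ g c n → 3 ≤ g → (4 * c ∸ 7) ^ 2 ≤ 32 * g ∸ 15 →
  4 * n + 8 * g ≤ 8 + n * (n ∸ 1) → 2 * c ≤ n
enoughVertices g c n 3≤g floor bound = ≮⇒≥ (refute n bound)
  where
  open ≤-Reasoning

  genusTooSmall : ∀ {k l} → k + 8 * g ≤ l → l < 24 → ⊥
  genusTooSmall {k} h l<24 =
    <⇒≱ l<24 (≤-trans (*-monoʳ-≤ 8 3≤g) (≤-trans (m≤n+m (8 * g) k) h))

  shift : ∀ r → (8 + (3 + r) * (2 + r)) * 4 ≡ ((2 * r + 1) * ((2 * r + 1) * 1) + 7) + 16 * (3 + r)
  shift = solve-∀

  quadruple : ∀ r g → (4 * (3 + r) + 8 * g) * 4 ≡ 32 * g + 16 * (3 + r)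
  quadruple = solve-∀

  refute : ∀ n → 4 * n + 8 * g ≤ 8 + n * (n ∸ 1) → n < 2 * c → ⊥
  -- For n ≤ 2 the right side of the bound is at most 10, whereas 8g ≥ 24.
  refute 0 h _ = genusTooSmall {0} h (m≤m+n 9 15)
  refute 1 h _ = genusTooSmall {4} h (m≤m+n 9 15)
  refute 2 h _ = genusTooSmall {8} h (m≤m+n 11 13)
  refute (suc (suc (suc r))) h n<2c =
    -- The chain would give (32g - 15) + 15 ≤ (32g - 15) + 7. The truncated subtraction is exact
    -- because g ≥ 3.
    <⇒≱ {32 * g ∸ 15 + 7} {32 * g ∸ 15 + 15} (+-monoʳ-< (32 * g ∸ 15) (m≤m+n 8 7)) (begin
    32 * g ∸ 15 + 15      ≡⟨ m∸n+n≡m (≤-trans (m≤m+n 15 81) (*-monoʳ-≤ 32 3≤g)) ⟩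
    32 * g                ≤⟨ +-cancelʳ-≤ (16 * (3 + r)) _ _ (begin
      32 * g + 16 * (3 + r)                 ≡⟨ quadruple r g ⟨
      (4 * (3 + r) + 8 * g) * 4             ≤⟨ *-monoˡ-≤ 4 h ⟩
      (8 + (3 + r) * (2 + r)) * 4           ≡⟨ shift r ⟩
      (2 * r + 1) ^ 2 + 7 + 16 * (3 + r)    ∎) ⟩
    (2 * r + 1) ^ 2 + 7   ≤⟨ +-monoˡ-≤ 7 (≤-trans (^-monoˡ-≤ 2 root) floor) ⟩
    32 * g ∸ 15 + 7       ∎)
    where
    expand : ∀ r → 2 * r + 1 + 7 ≡ 2 * (4 + r)
    expand = solve-∀
    quarter : ∀ c → 2 * (2 * c) ≡ 4 * c
    quarter = solve-∀
    root : 2 * r + 1 ≤ 4 * c ∸ 7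
    root = m+n≤o⇒m≤o∸n (2 * r + 1) (begin
      2 * r + 1 + 7 ≡⟨ expand r ⟩
      2 * (4 + r)   ≤⟨ *-monoʳ-≤ 2 n<2c ⟩
      2 * (2 * c)   ≡⟨ quarter c ⟩
      4 * c         ∎)

theorem1p1 : (g : ℕ) → 3 ≤ g →
    (c f : ℕ) →
    ⌈ [ 3 +√ (8 * g + 1) ]/ 2 ⌉≡ c →
    ⌊ [ 7 +√ (32 * g ∸ 15) ]/ 4 ⌋≡ f →
    c ≡ f →
    ∣V∣min[ g ]≡ (2 * c)
-- A ceiling below 2 would violate 3 ≤ 2c.
theorem1p1 g _ 0 _ ((() , _) , _) _ _
theorem1p1 g _ 1 _ ((s≤s (s≤s ()) , _) , _) _ _
-- The ceiling, as an upper bound for its surd, yields the construction; the floor, as a lower bound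
-- for the other, yields minimality.
theorem1p1 g 3≤g c@(suc (suc q)) .c ((_ , ceiling) , _) (floor , _) refl =
  quadrangulation q g (≤-triangle g q ceiling) ,
  λ n Q → enoughVertices g c n 3≤g floor (LowerBound.vertexBound Q)
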